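{- For every odd integer $q>1$ there exists a $q$-ary $2$-frameproof code of length $4$ and cardinality $2(q-1)^2+1$.
   Context: For $P\subseteq F^l$ over a finite alphabet $F$, $desc(P)=\{x\in F^l: \text{for every } i\in\{1,\ldots,l\} \text{ there is } y\in P \text{ with } x_i=y_i\}$. For an integer $c\geq 2$, a $c$-frameproof code of length $l$ is a subset $C\subseteq F^l$ with $desc(P)\cap C=P$ for every $P\subseteq C$ with $|P|\leq c$; it is $q$-ary if $|F|=q$. -}

module Defs where

open import Level using (Level; 0ℓ; suc; _⊔_)
open import Data.Nat.Base using (ℕ; _≤_)
open import Data.Fin.Base using (Fin)
open import Data.Vec.Base using (Vec; lookup)
open import Data.List.Base using (List; length)
import Data.List.Membership.Propositional as List
open import Data.List.Relation.Unary.Unique.Propositional using (Unique)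
open import Data.Product.Base using (∃-syntax; _×_)
open import Function.Bundles using (_⇔_)
open import Relation.Unary using (Pred; _∈_; _⊆_; _∩_; _≐_)
open import Relation.Binary.PropositionalEquality.Core using (_≡_)

private
  variable
    a ℓ : Level

-- Counting through a duplicate-free enumeration, not through a bijection
-- Fin n ↔ ∃ P, so that distinct proofs of x ∈ P are not counted separately.
HasCardinality : {A : Set a} → Pred A ℓ → ℕ → Set (a ⊔ ℓ)
HasCardinality {A = A} P n =
  ∃[ xs ] Unique xs × length xs ≡ n × (∀ (x : A) → x ∈ P ⇔ x List.∈ xs)

Word : Set a → ℕ → Set a
Word F l = Vec F l

desc : {F : Set a} {l : ℕ} → Pred (Word F l) ℓ → Pred (Word F l) (a ⊔ ℓ)
desc {l = l} P x = ∀ (i : Fin l) → ∃[ y ] y ∈ P × lookup x i ≡ lookup y i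

IsFrameproof : {F : Set} {l : ℕ} → ℕ → Pred (Word F l) 0ℓ → Set (suc 0ℓ)
IsFrameproof {F} {l} c C =
  ∀ (P : Pred (Word F l) 0ℓ) → P ⊆ C →
  ∀ (n : ℕ) → HasCardinality P n → n ≤ c →
  (desc P ∩ C) ≐ P

{-# OPTIONS --safe #-}

-- Let q = 1 + m with m even, and let ∞ be one of the symbols. For each of the
-- four places take m²/2 words with their only ∞ there, the other three entries
-- running through half of a Latin square of order m; the halves can be chosen so
-- that no two words share finite symbols at two places. With the word ∞∞∞∞ this
-- gives 2m² + 1 words. If the words y and z cover the word x, one of them agrees
-- with x at two of the three places other than the ∞ of x (at two of any three
-- places, if x = ∞∞∞∞), and so equals x.

module Submission where

open import Level using (0ℓ)
open import Data.Nat.Base using (ℕ; suc; _+_; _*_; _∸_; _^_; _≤_; _<_; s≤s; NonZero)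
open import Data.Nat.Properties using (+-assoc; +-comm; *-comm; m∸n+n≡m; <⇒≤)
open import Data.Nat.Divisibility using (_∤_; m%n≡0⇒n∣m)
open import Data.Nat.DivMod
  using (_%_; _/_; m%n<n; m<n⇒m%n≡m; m≡m%n+[m/n]*n; [m+n]%n≡m%n; %-distribˡ-+)
open import Data.Nat.Tactic.RingSolver using (solve-∀)
open import Data.Bool.Base using (Bool; true; false; _xor_)
import Data.Bool.Properties as Bool
open import Data.Fin.Base using (Fin; zero; suc; toℕ; fromℕ<; punchIn; punchOut)
open import Data.Fin.Patterns using (0F; 1F; 2F; 3F)
open import Data.Fin.Properties
  using (_≟_; all?; toℕ-injective; toℕ-fromℕ<; toℕ<n; punchIn-injective; punchInᵢ≢i;
         punchOut-injective; +↔⊎; *↔×; 1↔⊤; 2↔Bool)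
open import Data.Vec.Base using (lookup; tabulate)
open import Data.Vec.Properties using (lookup∘tabulate)
open import Data.List.Base using (List; []; _∷_; length; map; allFin; cartesianProduct)
open import Data.List.Properties using (length-++; length-map; length-tabulate)
open import Data.List.Membership.Propositional using () renaming (_∈_ to _∈ˡ_)
open import Data.List.Membership.Propositional.Properties using (∈-map⁻)
open import Data.List.Relation.Unary.All using ([]; _∷_; universal)
import Data.List.Relation.Unary.All.Properties as All
open import Data.List.Relation.Unary.Any using (here; there)
open import Data.List.Relation.Unary.Unique.Propositional using (Unique; []; _∷_)
open import Data.List.Relation.Unary.Unique.Propositional.Properties
  using (allFin⁺; cartesianProduct⁺) renaming (map⁺ to unique-map⁺)
open import Data.Maybe.Base using (Maybe; just; nothing)
open import Data.Maybe.Properties using (just-injective)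
open import Data.Product.Base using (Σ-syntax; _×_; _,_; proj₁; proj₂; ∃-syntax; ∃₂)
open import Data.Product.Function.NonDependent.Propositional using (_×-↔_)
open import Data.Sum.Base as Sum using (_⊎_; inj₁; inj₂)
open import Data.Sum.Function.Propositional using (_⊎-↔_)
open import Data.Unit.Base using (⊤; tt)
open import Function.Base using (_∘_)
open import Function.Bundles using (_↔_; _⇔_; module Equivalence)
open import Function.Construct.Composition using (_↔-∘_)
open import Function.Construct.Identity using (↔-id; ⇔-id)
open import Function.Construct.Symmetry using (↔-sym)
open import Relation.Nullary using (yes; no; contradiction)
open import Relation.Nullary.Decidable using (¬?; _→-dec_; from-yes)
open import Relation.Unary using (Pred; _∈_)
open import Relation.Binary.PropositionalEquality
open import Defs

2∤⇒odd : ∀ {q} → 2 ∤ q → ∃[ k ] q ≡ suc (2 * k)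
2∤⇒odd {q} 2∤q with q % 2 in eq | m%n<n q 2
... | 0 | _ = contradiction (m%n≡0⇒n∣m q 2 eq) 2∤q
... | 1 | _ = q / 2 , trans (m≡m%n+[m/n]*n q 2) (cong₂ _+_ eq (*-comm (q / 2) 2))
... | suc (suc _) | s≤s (s≤s ())

length-cartesianProduct : {A B : Set} (xs : List A) (ys : List B) →
  length (cartesianProduct xs ys) ≡ length xs * length ys
length-cartesianProduct []       ys = refl
length-cartesianProduct (x ∷ xs) ys =
  trans (length-++ (map (x ,_) ys))
        (cong₂ _+_ (length-map (x ,_) ys) (length-cartesianProduct xs ys))

two-of-three : {P Q : Pred (Fin 3) 0ℓ} → (∀ a → P a ⊎ Q a) →
  (∃₂ λ a b → a ≢ b × P a × P b) ⊎ (∃₂ λ a b → a ≢ b × Q a × Q b)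
two-of-three f with f 0F | f 1F | f 2F
... | inj₁ p | inj₁ p′ | _       = inj₁ (0F , 1F , (λ ()) , p , p′)
... | inj₁ p | inj₂ _  | inj₁ p′ = inj₁ (0F , 2F , (λ ()) , p , p′)
... | inj₂ _ | inj₁ p  | inj₁ p′ = inj₁ (1F , 2F , (λ ()) , p , p′)
... | inj₂ q | inj₂ q′ | _       = inj₂ (0F , 1F , (λ ()) , q , q′)
... | inj₂ q | inj₁ _  | inj₂ q′ = inj₂ (0F , 2F , (λ ()) , q , q′)
... | inj₁ _ | inj₂ q  | inj₂ q′ = inj₂ (1F , 2F , (λ ()) , q , q′)

-- Frameproofness as a condition on triples of words.

Covers : {F : Set} {l : ℕ} (x y z : Word F l) → Set
Covers x y z = ∀ i → lookup x i ≡ lookup y i ⊎ lookup x i ≡ lookup z i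

-- The set `P` is listed by at most two words, and a single word is treated as a pair `y`, `y`. The
-- length is `suc l` because in length 0 the empty word would be a descendant of the empty set.
noncovering⇒2-frameproof : {F : Set} {l : ℕ} (C : Pred (Word F (suc l)) 0ℓ) →
  (∀ {x y z} → x ∈ C → y ∈ C → z ∈ C → Covers x y z → x ≡ y ⊎ x ≡ z) →
  IsFrameproof 2 C
noncovering⇒2-frameproof {F} {l} C noncovering P P⊆C n (ys , _ , |ys|≡n , enum) n≤2 =
  (λ (x∈desc , x∈C) → inP x∈C ys |ys|≡n n≤2 enum x∈desc)
  , (λ {x} x∈P → (λ i → x , x∈P , refl) , P⊆C x∈P)
  where
  inP : ∀ {x} → x ∈ C → (ys : List (Word F (suc l))) → length ys ≡ n → n ≤ 2 →
        (∀ w → w ∈ P ⇔ w ∈ˡ ys) → x ∈ desc P → x ∈ P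
  inP _ [] _ _ enum x∈desc with x∈desc zero
  ... | y , y∈P , _ with Equivalence.to (enum y) y∈P
  ... | ()
  inP {x} x∈C (y ∷ []) _ _ enum x∈desc
    with noncovering x∈C (P⊆C y∈P) (P⊆C y∈P) (λ i → inj₁ (agrees i))
    where
    y∈P = Equivalence.from (enum y) (here refl)
    agrees : ∀ i → lookup x i ≡ lookup y i
    agrees i with x∈desc i
    ... | w , w∈P , eq with Equivalence.to (enum w) w∈P
    ... | here refl = eq
  ... | inj₁ refl = Equivalence.from (enum y) (here refl)
  ... | inj₂ refl = Equivalence.from (enum y) (here refl)
  inP {x} x∈C (y ∷ z ∷ []) _ _ enum x∈desc
    with noncovering x∈C (P⊆C y∈P) (P⊆C z∈P) covers
    where
    y∈P = Equivalence.from (enum y) (here refl)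
    z∈P = Equivalence.from (enum z) (there (here refl))
    covers : Covers x y z
    covers i with x∈desc i
    ... | w , w∈P , eq with Equivalence.to (enum w) w∈P
    ... | here refl         = inj₁ eq
    ... | there (here refl) = inj₂ eq
  ... | inj₁ refl = Equivalence.from (enum y) (here refl)
  ... | inj₂ refl = Equivalence.from (enum z) (there (here refl))
  inP _ (_ ∷ _ ∷ _ ∷ _) refl (s≤s (s≤s ())) _ _

-- Addition modulo `n` and its Latin square.

%-cancelˡ-+ : ∀ {n} .{{_ : NonZero n}} {a b c} → a < n → b < n → c < n →
  (a + b) % n ≡ (a + c) % n → b ≡ c
%-cancelˡ-+ {n} {a} a<n b<n c<n eq =
  trans (sym (undo b<n))
    (trans (cong (λ r → ((n ∸ a) % n + r) % n) eq) (undo c<n))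
  where
  open ≡-Reasoning
  -- `n ∸ a` is the negative of `a` modulo `n`, so adding it to the reduced sum brings back `b`.
  undo : ∀ {b} → b < n → ((n ∸ a) % n + (a + b) % n) % n ≡ b
  undo {b} b<n = begin
    ((n ∸ a) % n + (a + b) % n) % n ≡⟨ %-distribˡ-+ (n ∸ a) (a + b) n ⟨
    (n ∸ a + (a + b)) % n           ≡⟨ cong (_% n) (+-assoc (n ∸ a) a b) ⟨
    (n ∸ a + a + b) % n             ≡⟨ cong (λ r → (r + b) % n) (m∸n+n≡m (<⇒≤ a<n)) ⟩
    (n + b) % n                     ≡⟨ cong (_% n) (+-comm n b) ⟩
    (b + n) % n                     ≡⟨ [m+n]%n≡m%n b n ⟩
    b % n                           ≡⟨ m<n⇒m%n≡m b<n ⟩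
    b                               ∎

infixl 6 _⊕_

_⊕_ : ∀ {n} → Fin n → Fin n → Fin n
_⊕_ {suc n} a b = fromℕ< (m%n<n (toℕ a + toℕ b) (suc n))

⊕-comm : ∀ {n} (a b : Fin n) → a ⊕ b ≡ b ⊕ a
⊕-comm {suc n} a b = toℕ-injective (trans (toℕ-fromℕ< _)
  (trans (cong (_% suc n) (+-comm (toℕ a) (toℕ b))) (sym (toℕ-fromℕ< _))))

⊕-cancelˡ : ∀ {n} (a : Fin n) {b c} → a ⊕ b ≡ a ⊕ c → b ≡ c
⊕-cancelˡ {suc n} a {b} {c} eq =
  toℕ-injective (%-cancelˡ-+ (toℕ<n a) (toℕ<n b) (toℕ<n c)
    (trans (sym (toℕ-fromℕ< _)) (trans (cong toℕ eq) (toℕ-fromℕ< _))))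

⊕-cancelʳ : ∀ {n} (a : Fin n) {b c} → b ⊕ a ≡ c ⊕ a → b ≡ c
⊕-cancelʳ a {b} {c} eq = ⊕-cancelˡ a (trans (⊕-comm a b) (trans eq (⊕-comm c a)))

-- Row, column and entry of the cell `(s , t)` in the addition table of the integers modulo `n`.
latin : ∀ {n} → Fin 3 → Fin n → Fin n → Fin n
latin 0F s t = s
latin 1F s t = t
latin 2F s t = s ⊕ t

-- Row and column are the cell itself; from the entry and one of them, cancellation gives the other.
latin-injective : ∀ {n} a b {s t s′ t′ : Fin n} → a ≢ b →
  latin a s t ≡ latin a s′ t′ → latin b s t ≡ latin b s′ t′ → s ≡ s′ × t ≡ t′
latin-injective 0F 0F a≢b _    _    = contradiction refl a≢b
latin-injective 0F 1F _   refl refl = refl , refl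
latin-injective 0F 2F _   refl eq   = refl , ⊕-cancelˡ _ eq
latin-injective 1F 0F _   refl refl = refl , refl
latin-injective 1F 1F a≢b _    _    = contradiction refl a≢b
latin-injective 1F 2F _   refl eq   = ⊕-cancelʳ _ eq , refl
latin-injective 2F 0F _   eq   refl = refl , ⊕-cancelˡ _ eq
latin-injective 2F 1F _   eq   refl = ⊕-cancelʳ _ eq , refl
latin-injective 2F 2F a≢b _    _    = contradiction refl a≢b

-- Bit patterns that keep the four families of words apart.

-- Only the differences twist i j xor twist i k matter: each pair {j, k} must be
-- split by exactly one of the two rows i outside it.
twist : Fin 4 → Fin 4 → Bool
twist 1F 2F = true
twist 2F 3F = true
twist 3F 1F = true
twist _  _  = false

-- The pairs `i`, `i′` and `j`, `k` partition the four places, and `twist` is the cycle 1 → 2 → 3 →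
-- 1. If 0 is one of `j`, `k`, exactly one of the rows `i`, `i′` points to the other one. If 0 is
-- one of `i`, `i′`, its row is constantly `false`, while the other row points to exactly one of
-- `j`, `k`. The proof evaluates all cases.
twist-separates : ∀ i i′ j k → i ≢ i′ → j ≢ k → i ≢ j → i ≢ k → i′ ≢ j → i′ ≢ k →
  twist i j xor twist i k ≢ twist i′ j xor twist i′ k
twist-separates = from-yes
  (all? λ i → all? λ i′ → all? λ j → all? λ k →
   i ≢? i′ →-dec j ≢? k →-dec i ≢? j →-dec i ≢? k →-dec i′ ≢? j →-dec i′ ≢? k →-dec
   ¬? (twist i j xor twist i k Bool.≟ twist i′ j xor twist i′ k))
  where
  infix 4 _≢?_
  _≢?_ : (i j : Fin 4) → _
  i ≢? j = ¬? (i ≟ j)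

xor-cancelʳ : ∀ a {b c} → b xor a ≡ c xor a → b ≡ c
xor-cancelʳ false {false} {false} _ = refl
xor-cancelʳ false {true}  {true}  _ = refl
xor-cancelʳ true  {false} {false} _ = refl
xor-cancelʳ true  {true}  {true}  _ = refl

xor-translate : ∀ p a b → (p xor a) xor (p xor b) ≡ a xor b
xor-translate false a     b     = refl
xor-translate true  false false = refl
xor-translate true  false true  = refl
xor-translate true  true  false = refl
xor-translate true  true  true  = refl

inj₂-,-injective : {A B C : Set} {b b′ : B} {c c′ : C} →
  _≡_ {A = A ⊎ (B × C)} (inj₂ (b , c)) (inj₂ (b′ , c′)) → b ≡ b′ × c ≡ c′
inj₂-,-injective refl = refl , refl

-- The codewords and their agreements.

module _ (n : ℕ) where

  Alphabet : Set
  Alphabet = ⊤ ⊎ (Bool × Fin n)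

  pattern ∞ = inj₁ tt

  Alphabet↔Fin : Alphabet ↔ Fin (suc (2 * n))
  Alphabet↔Fin = ↔-sym ((1↔⊤ ⊎-↔ ((2↔Bool ×-↔ ↔-id (Fin n)) ↔-∘ *↔×)) ↔-∘ +↔⊎)

  -- nothing indexes the word ∞∞∞∞; otherwise the first component is the place
  -- of the only ∞.
  Index : Set
  Index = Maybe (Fin 4 × Bool × Fin n × Fin n)

  -- For fixed `i`, each value of `p` contributes one Latin square of order `n`. The two squares
  -- have disjoint symbols at every place `j` other than `i`, and `twist i j` decides which half of
  -- the finite symbols belongs to which `p` there.
  symbol : Index → Fin 4 → Alphabet
  symbol nothing                j = ∞
  symbol (just (i , p , s , t)) j with i ≟ j
  ... | yes _  = ∞
  -- `punchOut` numbers the three places other than `i` as row, column and entry.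
  ... | no i≢j = inj₂ (p xor twist i j , latin (punchOut i≢j) s t)

  codeword : Index → Word Alphabet 4
  codeword x = tabulate (symbol x)

  -- The value at `nothing` is an arbitrary choice: ∞∞∞∞ agrees with any other codeword at one place
  -- only, so any two places single it out.
  home : Index → Fin 4
  home nothing        = 0F
  home (just (i , _)) = i

  determined : ∀ x y {j k} → j ≢ k → home x ≢ j → home x ≢ k →
    symbol x j ≡ symbol y j → symbol x k ≡ symbol y k → x ≡ y
  determined nothing nothing _ _ _ _ _ = refl
  determined nothing (just (i , _)) {j} {k} j≢k _ _ ej ek with i ≟ j | i ≟ k
  -- The second word has its ∞ at `i` alone, so it cannot show ∞ at both places.
  ... | yes refl | yes refl = contradiction refl j≢k
  determined (just (i , _)) nothing {j} _ i≢j _ ej _ with i ≟ j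
  ... | yes i≡j = contradiction i≡j i≢j
  determined (just (i , p , s , t)) (just (i′ , p′ , s′ , t′)) {j} {k} j≢k i≢j i≢k ej ek
    with i ≟ i′
  determined (just (i , p , s , t)) (just (i , p′ , s′ , t′)) {j} {k} j≢k i≢j i≢k ej ek
    | yes refl with i ≟ j | i ≟ k
  ... | yes i≡j | _       = contradiction i≡j i≢j
  ... | no _    | yes i≡k = contradiction i≡k i≢k
  ... | no i≢j′ | no i≢k′
    -- Both words carry the same twist at `j`, so one common bit already fixes `p`; the Latin square
    -- then fixes `s` and `t`.
    with refl ← xor-cancelʳ (twist i j) {p} {p′} (proj₁ (inj₂-,-injective ej))
    with refl , refl ← latin-injective (punchOut i≢j′) (punchOut i≢k′)
           (j≢k ∘ punchOut-injective i≢j′ i≢k′)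
           (proj₂ (inj₂-,-injective ej)) (proj₂ (inj₂-,-injective ek))
    = refl
  determined (just (i , p , s , t)) (just (i′ , p′ , s′ , t′)) {j} {k} j≢k i≢j i≢k ej ek
    | no i≢i′ with i ≟ j | i ≟ k | i′ ≟ j | i′ ≟ k
  ... | yes i≡j | _       | _       | _       = contradiction i≡j i≢j
  ... | no _    | yes i≡k | _       | _       = contradiction i≡k i≢k
  -- The xor of the bits at `j` and `k` is free of `p` and `p′`, so agreement would equate the twist
  -- differences of rows `i` and `i′`. If `i′` were `j` or `k`, ∞ would equal a finite symbol.
  ... | no _    | no _    | no i′≢j | no i′≢k = contradiction
    (trans (sym (xor-translate p (twist i j) (twist i k)))
      (trans (cong₂ _xor_ (proj₁ (inj₂-,-injective ej)) (proj₁ (inj₂-,-injective ek)))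
        (xor-translate p′ (twist i′ j) (twist i′ k))))
    (twist-separates i i′ j k i≢i′ j≢k i≢j i≢k i′≢j i′≢k)

  determined-off-home : ∀ x y {a b} → a ≢ b →
    lookup (codeword x) (punchIn (home x) a) ≡ lookup (codeword y) (punchIn (home x) a) →
    lookup (codeword x) (punchIn (home x) b) ≡ lookup (codeword y) (punchIn (home x) b) →
    x ≡ y
  determined-off-home x y {a} {b} a≢b ea eb =
    determined x y (a≢b ∘ punchIn-injective (home x) a b)
      (punchInᵢ≢i (home x) a ∘ sym) (punchInᵢ≢i (home x) b ∘ sym)
      (symbols ea) (symbols eb)
    where
    symbols : ∀ {j} → lookup (codeword x) j ≡ lookup (codeword y) j → symbol x j ≡ symbol y j
    symbols {j} eq =
      trans (sym (lookup∘tabulate (symbol x) j)) (trans eq (lookup∘tabulate (symbol y) j))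

  codeword-injective : ∀ {x y} → codeword x ≡ codeword y → x ≡ y
  codeword-injective {x} {y} eq = determined-off-home x y {0F} {1F} (λ ())
    (cong (λ w → lookup w (punchIn (home x) 0F)) eq)
    (cong (λ w → lookup w (punchIn (home x) 1F)) eq)

  codewords-noncovering : ∀ x y z → Covers (codeword x) (codeword y) (codeword z) →
    x ≡ y ⊎ x ≡ z
  -- Pigeonhole on the three places off the home of `x`: one of the two covering words takes two of
  -- them.
  codewords-noncovering x y z covers with two-of-three (covers ∘ punchIn (home x))
  ... | inj₁ (_ , _ , a≢b , ea , eb) = inj₁ (determined-off-home x y a≢b ea eb)
  ... | inj₂ (_ , _ , a≢b , ea , eb) = inj₂ (determined-off-home x z a≢b ea eb)

  -- Enumeration of the code and its size.

  bits : List Bool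
  bits = false ∷ true ∷ []

  pairs : List (Fin n × Fin n)
  pairs = cartesianProduct (allFin n) (allFin n)

  finiteIndices : List (Fin 4 × Bool × Fin n × Fin n)
  finiteIndices = cartesianProduct (allFin 4) (cartesianProduct bits pairs)

  indices : List Index
  indices = nothing ∷ map just finiteIndices

  indices-unique : Unique indices
  indices-unique =
    All.map⁺ (universal (λ _ ()) _)
    ∷ unique-map⁺ just-injective
        (cartesianProduct⁺ (allFin⁺ 4)
          (cartesianProduct⁺ (((λ ()) ∷ []) ∷ [] ∷ [])
            (cartesianProduct⁺ (allFin⁺ n) (allFin⁺ n))))

  length-indices : length indices ≡ suc (4 * (2 * (n * n)))
  length-indices = cong suc (begin
    length (map just finiteIndices)
      ≡⟨ length-map just finiteIndices ⟩
    length finiteIndices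
      ≡⟨ length-cartesianProduct (allFin 4) (cartesianProduct bits pairs) ⟩
    4 * length (cartesianProduct bits pairs)
      ≡⟨ cong (4 *_) (length-cartesianProduct bits pairs) ⟩
    4 * (2 * length pairs)
      ≡⟨ cong (λ m → 4 * (2 * m)) (length-cartesianProduct (allFin n) (allFin n)) ⟩
    4 * (2 * (length (allFin n) * length (allFin n)))
      ≡⟨ cong (λ m → 4 * (2 * (m * m))) (length-tabulate {n = n} (λ i → i)) ⟩
    4 * (2 * (n * n)) ∎)
    where open ≡-Reasoning

  -- Membership in the list is taken as the definition, so the list enumerates the code by the
  -- identity equivalence.
  Code : Pred (Word Alphabet 4) 0ℓ
  Code w = w ∈ˡ map codeword indices

  Code-frameproof : IsFrameproof 2 Code
  Code-frameproof = noncovering⇒2-frameproof Code noncovering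
    where
    noncovering : ∀ {u v w} → u ∈ Code → v ∈ Code → w ∈ Code → Covers u v w → u ≡ v ⊎ u ≡ w
    noncovering u∈ v∈ w∈ covers
      with x , _ , refl ← ∈-map⁻ codeword {xs = indices} u∈
         | y , _ , refl ← ∈-map⁻ codeword {xs = indices} v∈
         | z , _ , refl ← ∈-map⁻ codeword {xs = indices} w∈
      = Sum.map (cong codeword) (cong codeword) (codewords-noncovering x y z covers)

  Code-cardinality : HasCardinality Code (2 * (2 * n) ^ 2 + 1)
  Code-cardinality =
    map codeword indices
    , unique-map⁺ (λ {x} {y} → codeword-injective {x} {y}) indices-unique
    , trans (length-map codeword indices) (trans length-indices (arith n))
    , λ _ → ⇔-id _
    where
    -- (2 * m) ^ 2 unfolded, since the solver does not treat _^_.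
    arith : ∀ m → suc (4 * (2 * (m * m))) ≡ 2 * (2 * m * (2 * m * 1)) + 1
    arith = solve-∀

theorem2 : ∀ (q : ℕ) → 1 < q → 2 ∤ q →
    Σ[ F ∈ Set ] (F ↔ Fin q) ×
    (Σ[ C ∈ Pred (Word F 4) 0ℓ ]
    IsFrameproof 2 C × HasCardinality C (2 * (q ∸ 1) ^ 2 + 1))
-- Once `q` is `suc (2 * k)`, `q ∸ 1` computes to `2 * k`, the number of finite symbols.
theorem2 q _ 2∤q with k , refl ← 2∤⇒odd 2∤q =
  Alphabet k , Alphabet↔Fin k , Code k , Code-frameproof k , Code-cardinality k
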